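{- Let $q$ be a prime power with $q\neq 2$. For every integer $k\ge 0$ there is an integer $\bar R_k=\bar R_k(q)$ such that for all integers $r\ge \bar R_k$, \[ \overline{\mathrm{ex}}_q(r,k)=\binom{r}{k}(q-1)^{r-k}. \]
   Context: $F_q$ is the finite field with $q$ elements. $\overline{\mathrm{ex}}_q(r,k)$ denotes the maximum number of distinct columns of a matrix over $F_q$ (with any number of rows) such that every column has exactly $k$ entries equal to $0$ and the matrix has rank at most $r$. -}

module Defs where

open import Level using (Level; _⊔_; suc)
open import Data.Nat using (ℕ; _≤_)
import Data.Nat as ℕ
open import Data.Fin using (Fin)
import Data.Fin as Fin
open import Data.Fin.Subset using (Subset; _∈_; ∣_∣)
open import Data.Product using (Σ; ∃; _×_; _,_)
open import Relation.Binary.PropositionalEquality using (_≡_; _≢_)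
open import Relation.Nullary using (¬_)
open import Function.Bundles using (_⇔_)
open import Algebra.Bundles using (CommutativeRing)

record Field (c ℓ : Level) : Set (suc (c ⊔ ℓ)) where
  field
    commutativeRing : CommutativeRing c ℓ
  open CommutativeRing commutativeRing public
  field
    0≉1     : ¬ (0# ≈ 1#)
    inverse : ∀ x → ¬ (x ≈ 0#) → ∃ λ y → (x * y) ≈ 1#

record FiniteField (c ℓ : Level) (q : ℕ) : Set (suc (c ⊔ ℓ)) where
  field
    field′ : Field c ℓ
  open Field field′ public
  field
    enum       : Fin q → Carrier
    enum-inj   : ∀ i j → enum i ≈ enum j → i ≡ j
    enum-surj  : ∀ x → ∃ λ i → enum i ≈ x

module _ {c ℓ : Level} (F : Field c ℓ) where
  open Field F

  Matrix : ℕ → ℕ → Set c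
  Matrix m n = Fin m → Fin n → Carrier

  sumF : (r : ℕ) → (Fin r → Carrier) → Carrier
  sumF ℕ.zero    f = 0#
  sumF (ℕ.suc r) f = f Fin.zero + sumF r (λ l → f (Fin.suc l))

  -- rank M ≤ r : the column space of M is spanned by (at most) r vectors,
  -- i.e. M = B C with B an m × r and C an r × n matrix.
  RankAtMost : ∀ {m n} → ℕ → Matrix m n → Set (c ⊔ ℓ)
  RankAtMost {m} {n} r M =
    Σ (Matrix m r) λ B → Σ (Matrix r n) λ C →
      ∀ i j → M i j ≈ sumF r (λ l → B i l * C l j)

  DistinctColumns : ∀ {m n} → Matrix m n → Set ℓ
  DistinctColumns {m} {n} M =
    ∀ j j′ → j ≢ j′ → ¬ (∀ i → M i j ≈ M i j′)

  ColumnsHaveKZeros : ∀ {m n} → ℕ → Matrix m n → Set ℓ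
  ColumnsHaveKZeros {m} {n} k M =
    ∀ j → ∃ λ (S : Subset m) → ∣ S ∣ ≡ k × (∀ i → (i ∈ S) ⇔ (M i j ≈ 0#))

  Admissible : ∀ {m n} → ℕ → ℕ → Matrix m n → Set (c ⊔ ℓ)
  Admissible r k M = DistinctColumns M × ColumnsHaveKZeros k M × RankAtMost r M

  ExBarEq : ℕ → ℕ → ℕ → Set (c ⊔ ℓ)
  ExBarEq r k N =
    (∃ λ m → Σ (Matrix m N) λ M → Admissible r k M) ×
    (∀ m n (M : Matrix m n) → Admissible r k M → n ≤ N)

open import Data.Nat.Primality using (Prime)
IsPrimePower : ℕ → Set
IsPrimePower q = ∃ λ p → ∃ λ e → Prime p × 1 ≤ e × q ≡ p ℕ.^ e

{-# OPTIONS --safe #-}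

-- Choosing s ≤ r rows that span the others reduces the problem to counting words x ∈ F^s for which
-- the chosen rows (the coordinates of x) and the remaining rows (functionals of x) together have k
-- zeros.  With no remaining rows the count is C(s, k)(q − 1)^(s − k).  If a remaining
-- functional involves two coordinates, it also vanishes on a positive proportion of the words with
-- k zero coordinates (here q ≥ 3 is needed); this loss, of order s^k, outweighs the words with fewer
-- than k zero coordinates, of order s^(k−1), that may be gained.  A zero functional leaves only the
-- latter.  Otherwise every functional is a multiple of a coordinate, so zeros are counted with
-- weights w i ≥ 1, and double counting the pairs (x, i) with x i = 0 gives the bound by induction on k.
-- For small s the trivial bound q^s is enough.
module Submission where

open import Defs
open import Level using (Level; _⊔_)
open import Data.Bool as Bool using (true; if_then_else_)
open import Data.Nat as ℕ using (ℕ; zero; suc; _≤_; _<_; _^_; _∸_; z≤n; s≤s; s≤s⁻¹; >-nonZero)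
import Data.Nat.Properties as ℕ
open import Data.Nat.Combinatorics using (_C_; nCk+nC[k+1]≡[n+1]C[k+1]; k>n⇒nCk≡0; nCn≡1)
open import Data.Nat.Tactic.RingSolver using (solve-∀)
open import Data.Fin as Fin using (Fin; zero; suc; punchIn; punchOut; remQuot; combine; splitAt; join)
import Data.Fin.Properties as Fin
open import Data.Fin.Subset using (Subset; ∣_∣; inside; outside)
open import Data.Vec using (Vec; []; _∷_; lookup; insertAt; tabulate; tail)
open import Data.Vec.Properties
  using (≡-dec; ∷-injective; insertAt-lookup; insertAt-punchIn; lookup∘tabulate; tabulate∘lookup;
         tabulate-cong; []=⇒lookup; lookup⇒[]=)
open import Data.Product using (∃; _×_; _,_; proj₁; proj₂; uncurry)
open import Data.Sum using (_⊎_; inj₁; inj₂)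
open import Relation.Nullary using (¬_; Dec; does; yes; no; contradiction; ¬?; decidable-stable; _×-dec_)
open import Relation.Nullary.Decidable using (map′; dec-true)
open import Relation.Binary using (Decidable; tri<; tri≈; tri>)
open import Relation.Binary.PropositionalEquality as ≡ using (_≡_; _≢_; module ≡-Reasoning)
open import Function using (_∘_; id)
open import Function.Bundles using (mk⇔; Equivalence)
open import Algebra.Properties.Semiring.Sum ℕ.+-*-semiring using ()
  renaming (sum to ∑ℕ; sum-cong-≗ to ∑ℕ-cong; ∑-comm to ∑ℕ-comm; ∑-distrib-+ to ∑ℕ-distrib-+;
            *-distribʳ-sum to *-distribʳ-∑ℕ)

-- Finite sums of natural numbers and indicators.

module Words where
  open import Data.Nat using (_+_; _*_; _≟_; _<?_; _≤?_)
  open import Data.Nat.Properties hiding (_≟_; _<?_; _≤?_)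
  open ≡ using (refl; sym; trans; cong; cong₂; subst)
  open import Algebra.Properties.Semiring.Sum +-*-semiring
    using (sum; sum-cong-≗; sum-remove; ∑-distrib-+; ∑-comm; *-distribˡ-sum)

  private variable
    n q r : ℕ

  sum-mono : (f h : Fin n → ℕ) → (∀ i → f i ≤ h i) → sum f ≤ sum h
  sum-mono {zero}  f h f≤h = z≤n
  sum-mono {suc n} f h f≤h = +-mono-≤ (f≤h zero) (sum-mono (f ∘ suc) (h ∘ suc) (f≤h ∘ suc))

  sum-const : ∀ n c → sum {n} (λ _ → c) ≡ n * c
  sum-const zero    c = refl
  sum-const (suc n) c = cong (c +_) (sum-const n c)

  sum-0 : ∀ n → sum {n} (λ _ → 0) ≡ 0
  sum-0 n = trans (sum-const n 0) (*-zeroʳ n)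

  sum-split : (f : Fin (suc n) → ℕ) (i : Fin (suc n)) → sum f ≡ f i + sum (f ∘ punchIn i)
  sum-split f i = sum-remove {i = i} f

  term≤sum : (f : Fin n → ℕ) (i : Fin n) → f i ≤ sum f
  term≤sum {suc n} f i = ≤-trans (m≤m+n (f i) _) (≤-reflexive (sym (sum-split f i)))

  -- Iverson bracket: cardinalities become sums, whose order can be exchanged.
  ⟦_⟧ : ∀ {a} {A : Set a} → Dec A → ℕ
  ⟦ d ⟧ = if does d then 1 else 0

  ⟦⟧-mono : ∀ {a b} {A : Set a} {B : Set b} (d : Dec A) (d′ : Dec B) → (A → B) → ⟦ d ⟧ ≤ ⟦ d′ ⟧
  ⟦⟧-mono (no _)  _        _ = z≤n
  ⟦⟧-mono (yes x) (yes _)  _ = ≤-refl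
  ⟦⟧-mono (yes x) (no ¬y)  f = contradiction (f x) ¬y

  ⟦⟧-cong : ∀ {a b} {A : Set a} {B : Set b} (d : Dec A) (d′ : Dec B) → (A → B) → (B → A) → ⟦ d ⟧ ≡ ⟦ d′ ⟧
  ⟦⟧-cong d d′ f h = ≤-antisym (⟦⟧-mono d d′ f) (⟦⟧-mono d′ d h)

  module _ {a} {A : Set a} where
    ⟦⟧-true : (d : Dec A) → A → ⟦ d ⟧ ≡ 1
    ⟦⟧-true (yes _) _ = refl
    ⟦⟧-true (no ¬x) x = contradiction x ¬x

    ⟦⟧-false : (d : Dec A) → ¬ A → ⟦ d ⟧ ≡ 0
    ⟦⟧-false (no _)  _  = refl
    ⟦⟧-false (yes x) ¬x = contradiction x ¬x

    ⟦⟧≤1 : (d : Dec A) → ⟦ d ⟧ ≤ 1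
    ⟦⟧≤1 (no _)  = z≤n
    ⟦⟧≤1 (yes _) = ≤-refl

  sum-δ : (i : Fin n) (h : Fin n → ℕ) → sum (λ j → ⟦ i Fin.≟ j ⟧ * h j) ≡ h i
  sum-δ {suc n} i h = begin
    sum (λ j → ⟦ i Fin.≟ j ⟧ * h j)                                   ≡⟨ sum-split (λ j → ⟦ i Fin.≟ j ⟧ * h j) i ⟩
    ⟦ i Fin.≟ i ⟧ * h i + sum (λ j → ⟦ i Fin.≟ punchIn i j ⟧ * h (punchIn i j))
      ≡⟨ cong₂ _+_ (cong (_* h i) (⟦⟧-true (i Fin.≟ i) refl))
                   (sum-cong-≗ {n} λ j → cong (_* h (punchIn i j)) (⟦⟧-false (i Fin.≟ punchIn i j) (Fin.punchInᵢ≢i i j ∘ sym))) ⟩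
    1 * h i + sum {n} (λ _ → 0)                                       ≡⟨ cong₂ _+_ (*-identityˡ (h i)) (sum-0 n) ⟩
    h i + 0                                                           ≡⟨ +-identityʳ (h i) ⟩
    h i                                                               ∎
    where open ≡-Reasoning

  -- Sums over all words of a given length.

  ∑ⱽ : ∀ {q} r → (Vec (Fin q) r → ℕ) → ℕ
  ∑ⱽ zero    f = f []
  ∑ⱽ (suc r) f = sum (λ a → ∑ⱽ r (λ x → f (a ∷ x)))

  ∑ⱽ-cong : ∀ r {f h : Vec (Fin q) r → ℕ} → (∀ x → f x ≡ h x) → ∑ⱽ r f ≡ ∑ⱽ r h
  ∑ⱽ-cong     zero    f≗h = f≗h []
  ∑ⱽ-cong {q} (suc r) f≗h = sum-cong-≗ {q} λ a → ∑ⱽ-cong r (λ x → f≗h (a ∷ x))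

  ∑ⱽ-mono : ∀ r {f h : Vec (Fin q) r → ℕ} → (∀ x → f x ≤ h x) → ∑ⱽ r f ≤ ∑ⱽ r h
  ∑ⱽ-mono zero    f≤h = f≤h []
  ∑ⱽ-mono (suc r) f≤h = sum-mono _ _ λ a → ∑ⱽ-mono r (λ x → f≤h (a ∷ x))

  ∑ⱽ-distrib-+ : ∀ r (f h : Vec (Fin q) r → ℕ) → ∑ⱽ r (λ x → f x + h x) ≡ ∑ⱽ r f + ∑ⱽ r h
  ∑ⱽ-distrib-+     zero    f h = refl
  ∑ⱽ-distrib-+ {q} (suc r) f h = trans (sum-cong-≗ {q} λ a → ∑ⱽ-distrib-+ r (f ∘ (a ∷_)) (h ∘ (a ∷_))) (∑-distrib-+ {q} _ _)

  ∑ⱽ-distribˡ-* : ∀ r c (f : Vec (Fin q) r → ℕ) → ∑ⱽ r (λ x → c * f x) ≡ c * ∑ⱽ r f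
  ∑ⱽ-distribˡ-*     zero    c f = refl
  ∑ⱽ-distribˡ-* {q} (suc r) c f = trans (sum-cong-≗ {q} λ a → ∑ⱽ-distribˡ-* r c (f ∘ (a ∷_))) (sym (*-distribˡ-sum {q} c _))

  ∑ⱽ-const : ∀ r c → ∑ⱽ {q} r (λ _ → c) ≡ q ^ r * c
  ∑ⱽ-const     zero    c = sym (+-identityʳ c)
  ∑ⱽ-const {q} (suc r) c = trans (sum-cong-≗ {q} λ _ → ∑ⱽ-const {q} r c)
    (trans (sum-const q (q ^ r * c)) (sym (*-assoc q (q ^ r) c)))

  ∑ⱽ-0 : ∀ r → ∑ⱽ {q} r (λ _ → 0) ≡ 0
  ∑ⱽ-0 {q} r = trans (∑ⱽ-const {q} r 0) (*-zeroʳ (q ^ r))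

  ∑ⱽ-sum-comm : ∀ r (f : Vec (Fin q) r → Fin n → ℕ) → ∑ⱽ r (λ x → sum (f x)) ≡ sum (λ i → ∑ⱽ r (λ x → f x i))
  ∑ⱽ-sum-comm             zero    f = refl
  ∑ⱽ-sum-comm {q} {n} (suc r) f = trans (sum-cong-≗ {q} λ a → ∑ⱽ-sum-comm r (λ x → f (a ∷ x))) (∑-comm {q} {n} _)

  -- Fubini for an arbitrary coordinate: `∑ⱽ` recurses on the first letter, and exchanging sums
  -- moves coordinate `i` to the front.
  ∑ⱽ-insertAt : ∀ r (f : Vec (Fin q) (suc r) → ℕ) (i : Fin (suc r)) →
                ∑ⱽ (suc r) f ≡ sum (λ a → ∑ⱽ r (λ x → f (insertAt x i a)))
  ∑ⱽ-insertAt     r       f zero    = refl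
  ∑ⱽ-insertAt {q} (suc r) f (suc i) =
    trans (sum-cong-≗ {q} λ b → ∑ⱽ-insertAt r (λ x → f (b ∷ x)) i) (∑-comm {q} {q} _)

  word≟ : (x y : Vec (Fin q) r) → Dec (x ≡ y)
  word≟ = ≡-dec Fin._≟_

  ∑ⱽ-δ : ∀ r (y : Vec (Fin q) r) → ∑ⱽ r (λ x → ⟦ word≟ y x ⟧) ≡ 1
  ∑ⱽ-δ zero    []      = refl
  ∑ⱽ-δ {q} (suc r) (b ∷ y) = begin
    sum (λ a → ∑ⱽ r (λ x → ⟦ word≟ (b ∷ y) (a ∷ x) ⟧))
      ≡⟨ sum-cong-≗ {q} (λ a → trans (∑ⱽ-cong r (λ x → lemma a x))
           (trans (∑ⱽ-distribˡ-* r ⟦ b Fin.≟ a ⟧ (λ x → ⟦ word≟ y x ⟧)) (cong (⟦ b Fin.≟ a ⟧ *_) (∑ⱽ-δ r y)))) ⟩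
    sum (λ a → ⟦ b Fin.≟ a ⟧ * 1)  ≡⟨ sum-δ b (λ _ → 1) ⟩
    1 ∎
    where
    open ≡-Reasoning
    lemma : ∀ a x → ⟦ word≟ (b ∷ y) (a ∷ x) ⟧ ≡ ⟦ b Fin.≟ a ⟧ * ⟦ word≟ y x ⟧
    lemma a x with b Fin.≟ a | word≟ y x
    ... | yes _ | yes _ = refl
    ... | yes _ | no _  = refl
    ... | no _  | yes _ = refl
    ... | no _  | no _  = refl

  sum-unique≤ : ∀ {a} {P : Fin n → Set a} (P? : ∀ j → Dec (P j)) → (∀ i j → P i → P j → i ≡ j) →
                sum (λ j → ⟦ P? j ⟧) ≤ 1
  sum-unique≤ {zero}  P? uniq = z≤n
  sum-unique≤ {suc n} P? uniq with P? zero
  ... | no _  = sum-unique≤ (P? ∘ suc) (λ i j Pi Pj → Fin.suc-injective (uniq (suc i) (suc j) Pi Pj))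
  ... | yes P0 = s≤s (≤-reflexive (trans
    (sum-cong-≗ {n} λ j → ⟦⟧-false (P? (suc j)) (λ Pj → contradiction (uniq zero (suc j) P0 Pj) λ ()))
    (sum-0 n)))

  -- Each index `j` contributes the single word `c j`; after the sums are exchanged, injectivity
  -- lets at most one `j` contribute to each word.
  injection⇒≤∑ⱽ : ∀ {a} {P : Vec (Fin q) r → Set a} (P? : ∀ x → Dec (P x)) (c : Fin n → Vec (Fin q) r) →
                  (∀ i j → c i ≡ c j → i ≡ j) → (∀ j → P (c j)) → n ≤ ∑ⱽ r (λ x → ⟦ P? x ⟧)
  injection⇒≤∑ⱽ {r = r} {n = n} P? c inj Pc = begin
    n                                                ≡⟨ *-identityʳ n ⟨
    n * 1                                            ≡⟨ sum-const n 1 ⟨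
    sum {n} (λ _ → 1)                                ≡⟨ sum-cong-≗ {n} (λ j → ∑ⱽ-δ r (c j)) ⟨
    sum (λ j → ∑ⱽ r (λ x → ⟦ word≟ (c j) x ⟧))       ≡⟨ ∑ⱽ-sum-comm r (λ x j → ⟦ word≟ (c j) x ⟧) ⟨
    ∑ⱽ r (λ x → sum (λ j → ⟦ word≟ (c j) x ⟧))       ≤⟨ ∑ⱽ-mono r hit ⟩
    ∑ⱽ r (λ x → ⟦ P? x ⟧)                            ∎
    where
    open ≤-Reasoning
    hit : ∀ x → sum (λ j → ⟦ word≟ (c j) x ⟧) ≤ ⟦ P? x ⟧
    hit x with P? x
    ... | yes _ = sum-unique≤ (λ j → word≟ (c j) x) (λ i j ei ej → inj i j (trans ei (sym ej)))
    ... | no ¬P = ≤-reflexive (trans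
      (sum-cong-≗ {n} λ j → ⟦⟧-false (word≟ (c j) x) (λ e → ¬P (subst _ e (Pc j))))
      (sum-0 n))

  -- Words with a prescribed number of zeros.

  -- ν p n k is the number of words of length n over p + 1 letters in which a given letter occurs
  -- k times; the recursion on the first letter gives C(n, k) pⁿ⁻ᵏ without subtraction.
  ν : ℕ → ℕ → ℕ → ℕ
  ν p zero    zero    = 1
  ν p zero    (suc k) = 0
  ν p (suc n) zero    = p * ν p n zero
  ν p (suc n) (suc k) = p * ν p n (suc k) + ν p n k

  ν≡0 : ∀ p n k → n < k → ν p n k ≡ 0
  ν≡0 p zero    (suc k) _         = refl
  ν≡0 p (suc n) (suc k) (s≤s n<k) =
    trans (cong₂ (λ u v → p * u + v) (ν≡0 p n (suc k) (m<n⇒m<1+n n<k)) (ν≡0 p n k n<k))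
          (cong (_+ 0) (*-zeroʳ p))

  -- The recursion is Pascal's rule. The comparison of `n` with `k` is needed because `n ∸ k` is the
  -- successor of `n ∸ suc k` only when `k < n`.
  ν-closed : ∀ p n k → ν p n k ≡ (n C k) * p ^ (n ∸ k)
  ν-closed p zero    zero    = refl
  ν-closed p zero    (suc k) = cong (_* p ^ 0) (sym (k>n⇒nCk≡0 {0} {suc k} (s≤s z≤n)))
  ν-closed p (suc n) zero    = begin
    p * ν p n 0            ≡⟨ cong (p *_) (ν-closed p n 0) ⟩
    p * (1 * p ^ n)        ≡⟨ cong (p *_) (*-identityˡ (p ^ n)) ⟩
    p * p ^ n              ≡⟨ *-identityˡ (p * p ^ n) ⟨
    1 * (p * p ^ n)        ∎
    where open ≡-Reasoning
  ν-closed p (suc n) (suc k) with <-cmp n k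
  ... | tri< n<k _ _ = trans (ν≡0 p (suc n) (suc k) (s≤s n<k))
                             (cong (_* p ^ (n ∸ k)) (sym (k>n⇒nCk≡0 (s≤s n<k))))
  ... | tri≈ _ refl _ = begin
    p * ν p n (suc n) + ν p n n        ≡⟨ cong₂ (λ u v → p * u + v) (ν≡0 p n (suc n) ≤-refl) (ν-closed p n n) ⟩
    p * 0 + (n C n) * p ^ (n ∸ n)      ≡⟨ cong₂ _+_ (*-zeroʳ p) (cong (_* p ^ (n ∸ n)) (trans (nCn≡1 n) (sym (nCn≡1 (suc n))))) ⟩
    (suc n C suc n) * p ^ (n ∸ n)      ∎
    where open ≡-Reasoning
  ... | tri> _ _ k<n = begin
    p * ν p n (suc k) + ν p n k                                ≡⟨ cong₂ (λ u v → p * u + v) (ν-closed p n (suc k)) (ν-closed p n k) ⟩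
    p * ((n C suc k) * p ^ (n ∸ suc k)) + (n C k) * p ^ (n ∸ k) ≡⟨ cong (λ e → p * ((n C suc k) * p ^ (n ∸ suc k)) + (n C k) * p ^ e) n∸k ⟩
    p * ((n C suc k) * p ^ (n ∸ suc k)) + (n C k) * (p * p ^ (n ∸ suc k))
                                                               ≡⟨ ring p (n C suc k) (n C k) (p ^ (n ∸ suc k)) ⟩
    ((n C k) + (n C suc k)) * (p * p ^ (n ∸ suc k))            ≡⟨ cong₂ _*_ (nCk+nC[k+1]≡[n+1]C[k+1] n k) (cong (p ^_) (sym n∸k)) ⟩
    (suc n C suc k) * p ^ (n ∸ k)                              ∎
    where
    open ≡-Reasoning
    n∸k : n ∸ k ≡ suc (n ∸ suc k)
    n∸k = +-∸-assoc 1 k<n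
    ring : ∀ p a b e → p * (a * e) + b * (p * e) ≡ (b + a) * (p * e)
    ring = solve-∀

  -- j ↦ ν p n j has ratio (n ∸ j) / ((j + 1) p), stated without subtraction.
  ν-ratio : ∀ p n j → suc j * (p * ν p n (suc j)) + j * ν p n j ≡ n * ν p n j
  ν-ratio p zero zero    = cong (λ u → u + 0 + 0) (*-zeroʳ p)
  ν-ratio p zero (suc j) = cong₂ _+_ (trans (cong (suc (suc j) *_) (*-zeroʳ p)) (*-zeroʳ (suc (suc j)))) (*-zeroʳ (suc j))
  ν-ratio p (suc n) zero = trans (ring₁ p (ν p n 1) (ν p n 0))
    (trans (cong (λ u → p * u + p * ν p n 0) (ν-ratio p n 0)) (ring₂ p n (ν p n 0)))
    where
    ring₁ : ∀ p a b → 1 * (p * (p * a + b)) + 0 ≡ p * (1 * (p * a) + 0 * b) + p * b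
    ring₁ = solve-∀
    ring₂ : ∀ p n b → p * (n * b) + p * b ≡ (1 + n) * (p * b)
    ring₂ = solve-∀
  ν-ratio p (suc n) (suc i) = trans (ring₁ p i (ν p n (2 + i)) (ν p n (1 + i)) (ν p n i))
    (trans (cong₂ (λ u v → p * u + p * ν p n (1 + i) + v + ν p n i) (ν-ratio p n (suc i)) (ν-ratio p n i))
           (ring₂ p n (ν p n (1 + i)) (ν p n i)))
    where
    ring₁ : ∀ p i a b c → (2 + i) * (p * (p * a + b)) + (1 + i) * (p * b + c)
                        ≡ p * ((2 + i) * (p * a) + (1 + i) * b) + p * b + ((1 + i) * (p * b) + i * c) + c
    ring₁ = solve-∀
    ring₂ : ∀ p n b c → p * (n * b) + p * b + n * c + c ≡ (1 + n) * (p * b + c)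
    ring₂ = solve-∀

  -- The absorption identity for binomial coefficients, in the form that closes the double counting
  -- of zeros.
  ν-absorb : ∀ p n k → suc k * ν p (suc n) (suc k) ≡ suc n * ν p n k
  ν-absorb p n k = trans (ring₁ p k (ν p n (suc k)) (ν p n k)) (trans (cong (_+ ν p n k) (ν-ratio p n k)) (+-comm (n * ν p n k) (ν p n k)))
    where
    ring₁ : ∀ p k a b → (1 + k) * (p * a + b) ≡ (1 + k) * (p * a) + k * b + b
    ring₁ = solve-∀

  ν-mono-suc : ∀ p → 1 ≤ p → ∀ n k → ν p n k ≤ ν p (suc n) k
  ν-mono-suc p 1≤p n zero    = m≤n*m (ν p n zero) p {{>-nonZero 1≤p}}
  ν-mono-suc p 1≤p n (suc k) = ≤-trans (m≤n*m (ν p n (suc k)) p {{>-nonZero 1≤p}})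
    (m≤m+n (p * ν p n (suc k)) (ν p n k))

  ν-mono : ∀ p → 1 ≤ p → ∀ {m n} k → m ≤ n → ν p m k ≤ ν p n k
  ν-mono p 1≤p {n = zero}  k z≤n = ≤-refl
  ν-mono p 1≤p {m} {suc n} k m≤n with m≤n⇒m<n∨m≡n m≤n
  ... | inj₁ (s≤s m≤n′) = ≤-trans (ν-mono p 1≤p k m≤n′) (ν-mono-suc p 1≤p n k)
  ... | inj₂ refl       = ≤-refl

  ν≥1 : ∀ p → 1 ≤ p → ∀ n → 1 ≤ ν p n n
  ν≥1 p 1≤p zero    = ≤-refl
  ν≥1 p 1≤p (suc n) = ≤-trans (ν≥1 p 1≤p n) (m≤n+m (ν p n n) (p * ν p n (suc n)))

  -- Already the words made of `n` nonzero letters followed by `k` zeros number `p ^ n`. This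
  -- exponential growth later beats the trivial bound for small rank.
  2^n≤ν : ∀ p → 2 ≤ p → ∀ n k → 2 ^ n ≤ ν p (n + k) k
  2^n≤ν p 2≤p zero    k = ν≥1 p (≤-trans (s≤s z≤n) 2≤p) k
  2^n≤ν p 2≤p (suc n) k = ≤-trans (*-mono-≤ 2≤p (2^n≤ν p 2≤p n k)) (step k)
    where
    step : ∀ k → p * ν p (n + k) k ≤ ν p (suc (n + k)) k
    step zero    = ≤-refl
    step (suc k) = m≤m+n _ _

  n≤2^n : ∀ n → n ≤ 2 ^ n
  n≤2^n zero    = z≤n
  n≤2^n (suc n) = ≤-trans (+-mono-≤ (m^n>0 2 n) (n≤2^n n)) (≤-reflexive (cong (2 ^ n +_) (sym (+-identityʳ (2 ^ n)))))

  -- Growth of the counts in the number of zeros.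

  module Growth (p : ℕ) (1≤p : 1 ≤ p) where

    q² : ℕ
    q² = suc p * suc p

    -- Up to j = k, the counts ν p n j with n ≥ threshold k grow by a factor 1 + q² in each step;
    -- the q² pays for the two coordinates used up by a functional that involves both.
    threshold : ℕ → ℕ
    threshold k = k * suc (p * suc q²)

    threshold-mono : ∀ {j k} → j ≤ k → threshold j ≤ threshold k
    threshold-mono = *-monoˡ-≤ (suc (p * suc q²))

    -- By `ν-ratio`, `(j + 1) p` times the right side is `n − j` times `ν p n j`, so
    -- `(j + 1) p (1 + q²) ≤ n − j` suffices. Adding `j * ν p n j` to both sides avoids the
    -- subtraction.
    ν-growth : ∀ n j → threshold (suc j) ≤ n → suc q² * ν p n j ≤ ν p n (suc j)
    ν-growth n j t≤n = *-cancelˡ-≤ p {{>-nonZero 1≤p}} (*-cancelˡ-≤ (suc j) (+-cancelʳ-≤ (j * ν p n j) _ _ (begin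
      suc j * (p * (suc q² * ν p n j)) + j * ν p n j    ≡⟨ ring (suc j) p (suc q²) (ν p n j) j ⟩
      (suc j * (p * suc q²) + j) * ν p n j              ≤⟨ *-monoˡ-≤ (ν p n j) (≤-trans lower t≤n) ⟩
      n * ν p n j                                       ≡⟨ ν-ratio p n j ⟨
      suc j * (p * ν p n (suc j)) + j * ν p n j         ∎)))
      where
      open ≤-Reasoning
      ring : ∀ a p Q g j → a * (p * (Q * g)) + j * g ≡ (a * (p * Q) + j) * g
      ring = solve-∀
      lower : suc j * (p * suc q²) + j ≤ threshold (suc j)
      lower = begin
        suc j * (p * suc q²) + j      ≤⟨ +-monoʳ-≤ (suc j * (p * suc q²)) (n≤1+n j) ⟩
        suc j * (p * suc q²) + suc j  ≡⟨ +-comm (suc j * (p * suc q²)) (suc j) ⟩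
        suc j + suc j * (p * suc q²)  ≡⟨ *-suc (suc j) (p * suc q²) ⟨
        suc j * suc (p * suc q²)      ∎

    ν-doubling : ∀ n j → threshold (suc j) ≤ n → 2 * ν p n j ≤ ν p n (suc j)
    ν-doubling n j t≤n = ≤-trans (*-monoˡ-≤ (ν p n j) {2} {suc q²} (s≤s (s≤s z≤n))) (ν-growth n j t≤n)

    -- Every step doubles at least, and `v` doublings exceed a factor `v + 1`. A coordinate of
    -- weight `v + 1` is thus paid for by the `v` zeros it saves.
    ν-multiple : ∀ n j v → threshold (v + j) ≤ n → suc v * ν p n j ≤ ν p n (v + j)
    ν-multiple n j zero    t≤n = ≤-reflexive (*-identityˡ (ν p n j))
    ν-multiple n j (suc v) t≤n = begin
      ν p n j + suc v * ν p n j          ≤⟨ +-monoˡ-≤ (suc v * ν p n j) (m≤m+n (ν p n j) (v * ν p n j)) ⟩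
      suc v * ν p n j + suc v * ν p n j  ≤⟨ +-mono-≤ ih ih ⟩
      ν p n (v + j) + ν p n (v + j)      ≡⟨ cong (ν p n (v + j) +_) (+-identityʳ (ν p n (v + j))) ⟨
      2 * ν p n (v + j)                  ≤⟨ ν-doubling n (v + j) t≤n ⟩
      ν p n (suc v + j)                  ∎
      where
      open ≤-Reasoning
      ih = ν-multiple n j v (≤-trans (threshold-mono (n≤1+n (v + j))) t≤n)

  -- Counting words by their number of zeros.

  module Counting (p : ℕ) (1≤p : 1 ≤ p) (𝟘 : Fin (suc p)) where

    open Growth p 1≤p

    -- The letter `𝟘` is arbitrary because an enumeration of a field may put zero anywhere.
    δ : Fin (suc p) → ℕ
    δ a = ⟦ 𝟘 Fin.≟ a ⟧

    zeros : Vec (Fin (suc p)) r → ℕ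
    zeros x = sum (λ l → δ (lookup x l))

    sum-δ′ : (h : ℕ → ℕ) → sum (λ a → h (δ a)) ≡ h 1 + p * h 0
    sum-δ′ h = begin
      sum (λ a → h (δ a))                             ≡⟨ sum-split (h ∘ δ) 𝟘 ⟩
      h (δ 𝟘) + sum (λ a → h (δ (punchIn 𝟘 a)))       ≡⟨ cong₂ _+_ (cong h (⟦⟧-true (𝟘 Fin.≟ 𝟘) refl))
                                                           (sum-cong-≗ {p} λ a → cong h (⟦⟧-false (𝟘 Fin.≟ punchIn 𝟘 a) (Fin.punchInᵢ≢i 𝟘 a ∘ sym))) ⟩
      h 1 + sum {p} (λ _ → h 0)                       ≡⟨ cong (h 1 +_) (sum-const p (h 0)) ⟩
      h 1 + p * h 0                                   ∎
      where open ≡-Reasoning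

    count-zeros : ∀ r k → ∑ⱽ r (λ x → ⟦ zeros x ≟ k ⟧) ≡ ν p r k
    count-zeros zero    zero    = refl
    count-zeros zero    (suc k) = refl
    count-zeros (suc r) zero    = trans (sum-δ′ λ d → ∑ⱽ r (λ x → ⟦ d + zeros x ≟ 0 ⟧))
      (cong₂ (λ u v → u + p * v) (∑ⱽ-0 {suc p} r) (count-zeros r zero))
    count-zeros (suc r) (suc k) = trans (sum-δ′ λ d → ∑ⱽ r (λ x → ⟦ d + zeros x ≟ suc k ⟧))
      (trans (cong₂ (λ u v → u + p * v) (count-zeros r k) (count-zeros r (suc k)))
             (+-comm (ν p r k) (p * ν p r (suc k))))

    -- These are the only words that additional rows can bring up to exactly `k` zeros.
    below : ℕ → ℕ → ℕ
    below r k = ∑ⱽ r (λ x → ⟦ zeros x <? k ⟧)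

    below-suc : ∀ r k → below r (suc k) ≡ below r k + ν p r k
    below-suc r k = trans (∑ⱽ-cong r (λ x → split (zeros x)))
      (trans (∑ⱽ-distrib-+ r (λ x → ⟦ zeros x <? k ⟧) (λ x → ⟦ zeros x ≟ k ⟧)) (cong (below r k +_) (count-zeros r k)))
      where
      split : ∀ m → ⟦ m <? suc k ⟧ ≡ ⟦ m <? k ⟧ + ⟦ m ≟ k ⟧
      split m with <-cmp m k
      ... | tri< m<k m≢k _ = trans (⟦⟧-true (m <? suc k) (m<n⇒m<1+n m<k))
            (sym (cong₂ _+_ (⟦⟧-true (m <? k) m<k) (⟦⟧-false (m ≟ k) m≢k)))
      ... | tri≈ m≮k m≡k _ = trans (⟦⟧-true (m <? suc k) (s≤s (≤-reflexive m≡k)))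
            (sym (cong₂ _+_ (⟦⟧-false (m <? k) m≮k) (⟦⟧-true (m ≟ k) m≡k)))
      ... | tri> m≮k m≢k k<m = trans (⟦⟧-false (m <? suc k) (<⇒≱ k<m ∘ s≤s⁻¹))
            (sym (cong₂ _+_ (⟦⟧-false (m <? k) m≮k) (⟦⟧-false (m ≟ k) m≢k)))

    -- Dropping the first letter creates no zero, and each shorter word has `suc p` extensions.
    below-suc-dim : ∀ r k → below (suc r) k ≤ suc p * below r k
    below-suc-dim r k = begin
      below (suc r) k                    ≤⟨ ∑ⱽ-mono (suc r) drop ⟩
      sum {suc p} (λ _ → below r k)      ≡⟨ sum-const (suc p) (below r k) ⟩
      suc p * below r k                  ∎
      where
      open ≤-Reasoning
      drop : ∀ (x : Vec (Fin (suc p)) (suc r)) → ⟦ zeros x <? k ⟧ ≤ ⟦ zeros (tail x) <? k ⟧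
      drop (a ∷ x) = ⟦⟧-mono (zeros (a ∷ x) <? k) (zeros x <? k) (≤-<-trans (m≤n+m (zeros x) (δ a)))

    -- In the induction, `q² * below n k` costs one copy of `ν p n k` and the new layer costs `q²`
    -- copies; the growth factor `1 + q²` covers both.
    q²*below≤ν : ∀ n k → threshold k ≤ n → q² * below n k ≤ ν p n k
    q²*below≤ν n zero    _   = ≤-trans
      (≤-reflexive (trans (cong (q² *_) (∑ⱽ-0 {suc p} n)) (*-zeroʳ q²))) z≤n
    q²*below≤ν n (suc k) t≤n = begin
      q² * below n (suc k)             ≡⟨ cong (q² *_) (below-suc n k) ⟩
      q² * (below n k + ν p n k)       ≡⟨ *-distribˡ-+ q² (below n k) (ν p n k) ⟩
      q² * below n k + q² * ν p n k    ≤⟨ +-monoˡ-≤ (q² * ν p n k) (q²*below≤ν n k (≤-trans (threshold-mono (n≤1+n k)) t≤n)) ⟩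
      suc q² * ν p n k                 ≤⟨ ν-growth n k t≤n ⟩
      ν p n (suc k)                    ∎
      where open ≤-Reasoning

    -- The right side has two coordinates fewer, to match the words that `vanishing-words` provides.
    below≤ν : ∀ n k → threshold k ≤ n → below (2 + n) k ≤ ν p n k
    below≤ν n k t≤n = begin
      below (2 + n) k                  ≤⟨ below-suc-dim (suc n) k ⟩
      suc p * below (suc n) k          ≤⟨ *-monoʳ-≤ (suc p) (below-suc-dim n k) ⟩
      suc p * (suc p * below n k)      ≡⟨ *-assoc (suc p) (suc p) (below n k) ⟨
      q² * below n k                   ≤⟨ q²*below≤ν n k t≤n ⟩
      ν p n k                          ∎
      where open ≤-Reasoning

    -- Zeros counted with weights.

    weight : (Fin r → ℕ) → Vec (Fin (suc p)) r → ℕ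
    weight w x = sum (λ l → w l * δ (lookup x l))

    weight-insertAt : ∀ (w : Fin (suc n) → ℕ) x i a →
                      weight w (insertAt x i a) ≡ w i * δ a + weight (w ∘ punchIn i) x
    weight-insertAt {n} w x i a = trans (sum-split (λ l → w l * δ (lookup (insertAt x i a) l)) i) (cong₂ _+_
      (cong (λ b → w i * δ b) (insertAt-lookup x i a))
      (sum-cong-≗ {n} λ l → cong (λ b → w (punchIn i l) * δ b) (insertAt-punchIn x i a l)))

    zeros-insertAt : ∀ (x : Vec (Fin (suc p)) n) i a → zeros (insertAt x i a) ≡ δ a + zeros x
    zeros-insertAt {n} x i a = trans (sum-split (λ l → δ (lookup (insertAt x i a) l)) i) (cong₂ _+_
      (cong δ (insertAt-lookup x i a)) (sum-cong-≗ {n} λ l → cong δ (insertAt-punchIn x i a l)))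

    zeros≤weight : ∀ (w : Fin r → ℕ) → (∀ i → 1 ≤ w i) → ∀ x → zeros x ≤ weight w x
    zeros≤weight {r} w 1≤w x = sum-mono {r} _ _ λ l →
      ≤-trans (≤-reflexive (sym (*-identityˡ _))) (*-monoˡ-≤ (δ (lookup x l)) (1≤w l))

    count-weight : ∀ r → (Fin r → ℕ) → ℕ → ℕ
    count-weight r w k = ∑ⱽ r (λ x → ⟦ weight w x ≟ k ⟧)

    -- Double counting of the pairs (x, i) with x i = 0, each with weight w i.
    double-count : ∀ (w : Fin (suc n) → ℕ) k →
      k * count-weight (suc n) w k ≡
      sum (λ i → w i * ∑ⱽ n (λ y → ⟦ w i + weight (w ∘ punchIn i) y ≟ k ⟧))
    double-count {n} w k = begin
      k * count-weight (suc n) w k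
        ≡⟨ ∑ⱽ-distribˡ-* (suc n) k hit ⟨
      ∑ⱽ (suc n) (λ x → k * ⟦ weight w x ≟ k ⟧)
        ≡⟨ ∑ⱽ-cong (suc n) (λ x → expand (weight w x)) ⟩
      ∑ⱽ (suc n) (λ x → ⟦ weight w x ≟ k ⟧ * weight w x)
        ≡⟨ ∑ⱽ-cong (suc n) (λ x → *-distribˡ-sum {suc n} ⟦ weight w x ≟ k ⟧ (λ l → w l * δ (lookup x l))) ⟩
      ∑ⱽ (suc n) (λ x → sum (λ i → ⟦ weight w x ≟ k ⟧ * (w i * δ (lookup x i))))
        ≡⟨ ∑ⱽ-sum-comm (suc n) mark ⟩
      sum (λ i → ∑ⱽ (suc n) (λ x → ⟦ weight w x ≟ k ⟧ * (w i * δ (lookup x i))))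
        ≡⟨ sum-cong-≗ {suc n} term ⟩
      sum (λ i → w i * ∑ⱽ n (λ y → ⟦ w i + weight (w ∘ punchIn i) y ≟ k ⟧)) ∎
      where
      open ≡-Reasoning
      hit : Vec (Fin (suc p)) (suc n) → ℕ
      hit x = ⟦ weight w x ≟ k ⟧
      mark : Vec (Fin (suc p)) (suc n) → Fin (suc n) → ℕ
      mark x i = hit x * (w i * δ (lookup x i))
      expand : ∀ m → k * ⟦ m ≟ k ⟧ ≡ ⟦ m ≟ k ⟧ * m
      expand m = by-cases (m ≟ k)
        where
        by-cases : (d : Dec (m ≡ k)) → k * ⟦ d ⟧ ≡ ⟦ d ⟧ * m
        by-cases (yes refl) = *-comm k 1
        by-cases (no _)     = *-zeroʳ k
      term : ∀ i → ∑ⱽ (suc n) (λ x → ⟦ weight w x ≟ k ⟧ * (w i * δ (lookup x i))) ≡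
                   w i * ∑ⱽ n (λ y → ⟦ w i + weight (w ∘ punchIn i) y ≟ k ⟧)
      term i = begin
        ∑ⱽ (suc n) (λ x → ⟦ weight w x ≟ k ⟧ * (w i * δ (lookup x i)))
          ≡⟨ ∑ⱽ-insertAt n (λ x → mark x i) i ⟩
        sum (λ a → ∑ⱽ n (λ y → ⟦ weight w (insertAt y i a) ≟ k ⟧ * (w i * δ (lookup (insertAt y i a) i))))
          ≡⟨ sum-cong-≗ {suc p} (λ a → ∑ⱽ-cong n λ y → cong₂ (λ u b → ⟦ u ≟ k ⟧ * (w i * δ b))
               (weight-insertAt w y i a) (insertAt-lookup y i a)) ⟩
        sum (λ a → ∑ⱽ n (λ y → ⟦ w i * δ a + weight (w ∘ punchIn i) y ≟ k ⟧ * (w i * δ a)))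
          ≡⟨ sum-δ′ (λ d → ∑ⱽ n (λ y → ⟦ w i * d + weight (w ∘ punchIn i) y ≟ k ⟧ * (w i * d))) ⟩
        _ + p * _
          -- Only the letter `𝟘` at position `i` contributes; for the other `p` letters the factor
          -- `w i * d` is zero.
          ≡⟨ cong₂ (λ u v → u + p * v) at1 at0 ⟩
        w i * c + p * 0
          ≡⟨ cong (w i * c +_) (*-zeroʳ p) ⟩
        w i * c + 0
          ≡⟨ +-identityʳ (w i * c) ⟩
        w i * c ∎
        where
        c : ℕ
        c = ∑ⱽ n (λ y → ⟦ w i + weight (w ∘ punchIn i) y ≟ k ⟧)
        at1 : ∑ⱽ n (λ y → ⟦ w i * 1 + weight (w ∘ punchIn i) y ≟ k ⟧ * (w i * 1)) ≡ w i * c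
        at1 = trans (∑ⱽ-cong n λ y → trans
                      (cong (λ u → ⟦ u + weight (w ∘ punchIn i) y ≟ k ⟧ * u) (*-identityʳ (w i)))
                      (*-comm _ (w i)))
                    (∑ⱽ-distribˡ-* n (w i) (λ y → ⟦ w i + weight (w ∘ punchIn i) y ≟ k ⟧))
        at0 : ∑ⱽ n (λ y → ⟦ w i * 0 + weight (w ∘ punchIn i) y ≟ k ⟧ * (w i * 0)) ≡ 0
        at0 = trans (∑ⱽ-cong n λ y → trans
                      (cong (⟦ w i * 0 + weight (w ∘ punchIn i) y ≟ k ⟧ *_) (*-zeroʳ (w i)))
                      (*-zeroʳ ⟦ w i * 0 + weight (w ∘ punchIn i) y ≟ k ⟧))
                    (∑ⱽ-0 {suc p} n)

    -- Fixing a zero at `i` lowers the target by `w i` and multiplies the count by `w i`; by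
    -- induction and `ν-multiple` each term is at most `ν p n k`, and absorption sums these bounds.
    -- The target may drop by more than one, so the recursion runs on its upper bound `b`.
    count-weight-rec : ∀ b k → k ≤ b → ∀ r (w : Fin r → ℕ) → (∀ i → 1 ≤ w i) → threshold k ≤ r →
                       count-weight r w k ≤ ν p r k
    count-weight-rec b zero _ r w 1≤w _ = ≤-trans
      (∑ⱽ-mono r (λ x → ⟦⟧-mono (weight w x ≟ 0) (zeros x ≟ 0)
        (λ e → n≤0⇒n≡0 (≤-trans (zeros≤weight w 1≤w x) (≤-reflexive e)))))
      (≤-reflexive (count-zeros r 0))
    -- `threshold (suc k)` is a successor, so the word is nonempty here.
    count-weight-rec (suc b) (suc k) (s≤s k≤b) (suc n) w 1≤w (s≤s t≤n) = *-cancelˡ-≤ (suc k) (begin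
      suc k * count-weight (suc n) w (suc k)
        ≡⟨ double-count w (suc k) ⟩
      sum (λ i → w i * ∑ⱽ n (λ y → ⟦ w i + weight (w ∘ punchIn i) y ≟ suc k ⟧))
        ≤⟨ sum-mono {suc n} _ _ (λ i → term (w i) (1≤w i) (w ∘ punchIn i) (1≤w ∘ punchIn i)) ⟩
      sum {suc n} (λ _ → ν p n k)
        ≡⟨ sum-const (suc n) (ν p n k) ⟩
      suc n * ν p n k
        ≡⟨ ν-absorb p n k ⟨
      suc k * ν p (suc n) (suc k) ∎)
      where
      open ≤-Reasoning
      t≤n′ : threshold k ≤ n
      t≤n′ = ≤-trans (m≤n+m (threshold k) (p * suc q²)) t≤n
      term : ∀ c → 1 ≤ c → (w′ : Fin n → ℕ) → (∀ i → 1 ≤ w′ i) →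
             c * ∑ⱽ n (λ y → ⟦ c + weight w′ y ≟ suc k ⟧) ≤ ν p n k
      term (suc v) _ w′ 1≤w′ with v ≤? k
      ... | yes v≤k = begin
        suc v * ∑ⱽ n (λ y → ⟦ suc v + weight w′ y ≟ suc k ⟧)
          ≤⟨ *-monoʳ-≤ (suc v) (∑ⱽ-mono n λ y → ⟦⟧-mono (suc v + weight w′ y ≟ suc k) (weight w′ y ≟ k ∸ v)
               (λ e → trans (sym (m+n∸m≡n v (weight w′ y))) (cong (_∸ v) (suc-injective e)))) ⟩
        suc v * count-weight n w′ (k ∸ v)
          ≤⟨ *-monoʳ-≤ (suc v) (count-weight-rec b (k ∸ v) (≤-trans (m∸n≤m k v) k≤b) n w′ 1≤w′
               (≤-trans (threshold-mono (m∸n≤m k v)) t≤n′)) ⟩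
        suc v * ν p n (k ∸ v)
          ≤⟨ ν-multiple n (k ∸ v) v (subst (λ j → threshold j ≤ n) (sym (m+[n∸m]≡n v≤k)) t≤n′) ⟩
        ν p n (v + (k ∸ v))
          ≡⟨ cong (ν p n) (m+[n∸m]≡n v≤k) ⟩
        ν p n k ∎
      -- A zero at this coordinate alone already exceeds the target weight, so no word is counted.
      ... | no v≰k = ≤-trans (≤-reflexive (trans (cong (suc v *_)
          (trans (∑ⱽ-cong n (λ y → ⟦⟧-false (suc v + weight w′ y ≟ suc k)
                   (λ e → v≰k (m+n≤o⇒m≤o v (≤-reflexive (suc-injective e))))))
                 (∑ⱽ-0 {suc p} n)))
          (*-zeroʳ (suc v)))) z≤n

    count-weight≤ν : ∀ k r (w : Fin r → ℕ) → (∀ i → 1 ≤ w i) → threshold k ≤ r →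
                     count-weight r w k ≤ ν p r k
    count-weight≤ν k = count-weight-rec k k ≤-refl

open Words

-- Linear algebra: spanning rows and rank factorizations.

module Linear {c ℓ} (F : Field c ℓ) (_≈?_ : Decidable (Field._≈_ F)) where
  open Field F hiding (zero)
  open import Algebra.Properties.Semiring.Sum semiring
    using (sum; sum-cong-≋; sum-remove; ∑-distrib-+; ∑-comm; *-distribˡ-sum; *-distribʳ-sum; sum-replicate-zero)
  open import Algebra.Properties.Group +-group using (//-rightDividesˡ)
  open import Algebra.Properties.Ring ring using ([y-z]x≈yx-zx)
  open import Algebra.Properties.CommutativeSemigroup +-commutativeSemigroup using (x∙yz≈y∙xz)
  open import Relation.Binary.Reasoning.Setoid setoid

  sumF≈sum : ∀ r (f : Fin r → Carrier) → sumF F r f ≈ sum f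
  sumF≈sum zero    f = refl
  sumF≈sum (suc r) f = +-congˡ (sumF≈sum r (f ∘ suc))

  sum-zero : ∀ {n} (f : Fin n → Carrier) → (∀ i → f i ≈ 0#) → sum f ≈ 0#
  sum-zero {n} f f≈0 = trans (sum-cong-≋ {n} f≈0) (sum-replicate-zero n)

  sum-only : ∀ {n} (f : Fin n → Carrier) i → (∀ j → i ≢ j → f j ≈ 0#) → sum f ≈ f i
  sum-only {suc n} f i f≈0 = begin
    sum f                            ≈⟨ sum-remove {i = i} f ⟩
    f i + sum {n} (f ∘ punchIn i)    ≈⟨ +-congˡ (sum-zero (f ∘ punchIn i) λ j → f≈0 _ (Fin.punchInᵢ≢i i j ∘ ≡.sym)) ⟩
    f i + 0#                         ≈⟨ +-identityʳ (f i) ⟩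
    f i                              ∎

  x-y+y≈x : ∀ x y → (x - y) + y ≈ x
  x-y+y≈x x y = //-rightDividesˡ y x

  *-cancelˡ-≉0 : ∀ a x y → ¬ a ≈ 0# → a * x ≈ a * y → x ≈ y
  *-cancelˡ-≉0 a x y a≉0 ax≈ay = let b , ab≈1 = inverse a a≉0 in begin
    x              ≈⟨ *-identityˡ x ⟨
    1# * x         ≈⟨ *-congʳ (trans (*-comm b a) ab≈1) ⟨
    b * a * x      ≈⟨ *-assoc b a x ⟩
    b * (a * x)    ≈⟨ *-congˡ ax≈ay ⟩
    b * (a * y)    ≈⟨ *-assoc b a y ⟨
    b * a * y      ≈⟨ *-congʳ (trans (*-comm b a) ab≈1) ⟩
    1# * y         ≈⟨ *-identityˡ y ⟩
    y              ∎

  -- The matrix is split into `s` spanning rows and the `rest`. `sum-rows` expresses that each row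
  -- is listed exactly once, in the form used to count zeros.
  record RowBasis {m r} (B : Matrix F m r) (s : ℕ) : Set (c ⊔ ℓ) where
    field
      {extra}    : ℕ
      basis      : Fin s → Fin m
      rest       : Fin extra → Fin m
      coeff      : Matrix F extra s
      dependence : ∀ u j → B (rest u) j ≈ sum (λ l → coeff u l * B (basis l) j)
      covers     : ∀ i → (∃ λ l → basis l ≡ i) ⊎ (∃ λ u → rest u ≡ i)
      sum-rows   : ∀ f → ∑ℕ f ≡ ∑ℕ (f ∘ basis) ℕ.+ ∑ℕ (f ∘ rest)

  add-zero-column : ∀ {m r s} (B : Matrix F m (suc r)) → (∀ i → B i zero ≈ 0#) →
                    RowBasis (λ i j → B i (suc j)) s → RowBasis B s
  add-zero-column {s = s} B B0≈0 rb = record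
    { basis = basis ; rest = rest ; coeff = coeff
    ; dependence = λ where
        u zero    → trans (B0≈0 (rest u)) (sym (sum-zero (λ l → coeff u l * B (basis l) zero)
                      λ l → trans (*-congˡ (B0≈0 (basis l))) (zeroʳ (coeff u l))))
        u (suc j) → dependence u j
    ; covers = covers ; sum-rows = sum-rows }
    where open RowBasis rb

  -- One step of Gaussian elimination: a row basis of the matrix reduced by multiples `t u` of row
  -- `i` becomes one of `B` once row `i` is added.
  add-pivot : ∀ {m r s} (B : Matrix F (suc m) r) i (t : Fin m → Carrier) →
              RowBasis (λ u j → B (punchIn i u) j - t u * B i j) s → RowBasis B (suc s)
  add-pivot {m} {r} {s} B i t rb = record
    { basis = basis′ ; rest = punchIn i ∘ rest ; coeff = coeff′
    ; dependence = dependence′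
    ; covers = covers′
    ; sum-rows = λ f → ≡.trans (sum-split f i)
        (≡.trans (≡.cong (f i ℕ.+_) (sum-rows (f ∘ punchIn i))) (≡.sym (ℕ.+-assoc (f i) _ _))) }
    where
    open RowBasis rb
    basis′ : Fin (suc s) → Fin (suc m)
    basis′ zero    = i
    basis′ (suc l) = punchIn i (basis l)
    coeff′ : Matrix F extra (suc s)
    -- The pivot row gets back what was subtracted from the dependent row, minus what was subtracted
    -- from the basis rows.
    coeff′ u zero    = t (rest u) - sum (λ l → coeff u l * t (basis l))
    coeff′ u (suc l) = coeff u l
    covers′ : ∀ i′ → (∃ λ l → basis′ l ≡ i′) ⊎ (∃ λ u → punchIn i (rest u) ≡ i′)
    covers′ i′ with i Fin.≟ i′
    ... | yes i≡i′ = inj₁ (zero , i≡i′)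
    ... | no i≢i′ with covers (punchOut i≢i′)
    ...   | inj₁ (l , eq) = inj₁ (suc l , ≡.trans (≡.cong (punchIn i) eq) (Fin.punchIn-punchOut i≢i′))
    ...   | inj₂ (u , eq) = inj₂ (u , ≡.trans (≡.cong (punchIn i) eq) (Fin.punchIn-punchOut i≢i′))
    dependence′ : ∀ u j → B (punchIn i (rest u)) j ≈ sum (λ l → coeff′ u l * B (basis′ l) j)
    dependence′ u j = begin
      X                              ≈⟨ x-y+y≈x X (t (rest u) * x) ⟨
      (X - t (rest u) * x) + t (rest u) * x       ≈⟨ +-cong (dependence u j) (sym (x-y+y≈x (t (rest u) * x) (S * x))) ⟩
      P + ((t (rest u) * x - S * x) + S * x)  ≈⟨ x∙yz≈y∙xz P _ (S * x) ⟩
      (t (rest u) * x - S * x) + (P + S * x)  ≈⟨ +-cong ([y-z]x≈yx-zx x (t (rest u)) S) (sym P+Sx) ⟨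
      (t (rest u) - S) * x + T           ∎
      where
      X x S P T : Carrier
      X = B (punchIn i (rest u)) j
      x = B i j
      Y : Fin s → Carrier
      Y l = B (punchIn i (basis l)) j
      S = sum (λ l → coeff u l * t (basis l))
      P = sum (λ l → coeff u l * (Y l - t (basis l) * x))
      T = sum (λ l → coeff u l * Y l)
      P+Sx : P + S * x ≈ T
      P+Sx = begin
        P + S * x
          ≈⟨ +-congˡ (*-distribʳ-sum {s} x _) ⟩
        P + sum {s} (λ l → coeff u l * t (basis l) * x)
          ≈⟨ ∑-distrib-+ {s} _ _ ⟨
        sum {s} (λ l → coeff u l * (Y l - t (basis l) * x) + coeff u l * t (basis l) * x)
          ≈⟨ sum-cong-≋ {s} (λ l → trans (+-congˡ (*-assoc (coeff u l) (t (basis l)) x))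
               (trans (sym (distribˡ (coeff u l) _ _)) (*-congˡ (x-y+y≈x (Y l) (t (basis l) * x))))) ⟩
        T ∎

  -- Elimination column by column: a zero column is skipped and any other supplies one pivot row, so
  -- at most `r` rows are chosen.
  rowBasis : ∀ r {m} (B : Matrix F m r) → ∃ λ s → s ≤ r × RowBasis B s
  rowBasis zero B = 0 , z≤n , record
    { basis = λ () ; rest = id ; coeff = λ _ () ; dependence = λ _ ()
    ; covers = λ i → inj₂ (i , ≡.refl) ; sum-rows = λ f → ≡.refl }
  rowBasis (suc r) {m} B with Fin.any? (λ i → ¬? (B i zero ≈? 0#))
  rowBasis (suc r) {m} B | no all-zero =
    let s , s≤r , rb = rowBasis r (λ i j → B i (suc j)) in
    s , ℕ.m≤n⇒m≤1+n s≤r ,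
    add-zero-column B (λ i → decidable-stable (B i zero ≈? 0#) λ Bi≉0 → all-zero (i , Bi≉0)) rb
  rowBasis (suc r) {suc m} B | yes (i , Bi≉0) =
    let s , s≤r , rb = rowBasis r (λ u j → B (punchIn i u) (suc j) - t u * B i (suc j)) in
    suc s , s≤s s≤r , add-pivot B i t (add-zero-column _ eliminated rb)
    where
    -- The quotient by the pivot entry, which clears the first column.
    t : Fin m → Carrier
    t u = B (punchIn i u) zero * proj₁ (inverse (B i zero) Bi≉0)
    eliminated : ∀ u → B (punchIn i u) zero - t u * B i zero ≈ 0#
    eliminated u = trans (+-congˡ (-‿cong (trans (*-assoc (B (punchIn i u) zero) _ (B i zero))
      (trans (*-congˡ (trans (*-comm _ (B i zero)) (proj₂ (inverse (B i zero) Bi≉0)))) (*-identityʳ _)))))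
      (-‿inverseʳ _)

  -- Right multiplication by `C` carries the row dependences of `B` over to `M`.
  factor-dependence : ∀ {m n r s} {M : Matrix F m n} (B : Matrix F m r) (C : Matrix F r n) →
    (∀ i j → M i j ≈ sumF F r (λ l → B i l * C l j)) → (rb : RowBasis B s) → let open RowBasis rb in
    ∀ u j → M (rest u) j ≈ sum (λ l → coeff u l * M (basis l) j)
  factor-dependence {r = r} {s} {M} B C M≈BC rb u j = begin
    M (rest u) j
      ≈⟨ product (rest u) ⟩
    sum {r} (λ h → B (rest u) h * C h j)
      ≈⟨ sum-cong-≋ {r} (λ h → trans (*-congʳ (dependence u h)) (*-distribʳ-sum {s} (C h j) _)) ⟩
    sum {r} (λ h → sum {s} (λ l → coeff u l * B (basis l) h * C h j))
      ≈⟨ ∑-comm {r} {s} _ ⟩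
    sum {s} (λ l → sum {r} (λ h → coeff u l * B (basis l) h * C h j))
      ≈⟨ sum-cong-≋ {s} (λ l → trans (sum-cong-≋ {r} λ h → *-assoc (coeff u l) _ _)
           (sym (trans (*-congˡ (product (basis l))) (*-distribˡ-sum {r} (coeff u l) _)))) ⟩
    sum {s} (λ l → coeff u l * M (basis l) j) ∎
    where
    open RowBasis rb
    product : ∀ i → M i j ≈ sum {r} (λ h → B i h * C h j)
    product i = trans (M≈BC i j) (sumF≈sum r _)

-- Cardinalities and finite case distinction.

card≡∑ : ∀ {m} (S : Subset m) → ∣ S ∣ ≡ ∑ℕ (λ i → ⟦ lookup S i Bool.≟ inside ⟧)
card≡∑ []            = ≡.refl
card≡∑ (inside ∷ S)  = ≡.cong suc (card≡∑ S)
card≡∑ (outside ∷ S) = card≡∑ S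

any⊎all : ∀ {n a b} {P : Fin n → Set a} {Q : Fin n → Set b} →
          (∀ i → P i ⊎ Q i) → ∃ P ⊎ (∀ i → Q i)
any⊎all {zero}  _  = inj₂ λ ()
any⊎all {suc n} PQ with PQ zero | any⊎all (PQ ∘ suc)
... | inj₁ P0 | _             = inj₁ (zero , P0)
... | inj₂ _  | inj₁ (i , Pi) = inj₁ (suc i , Pi)
... | inj₂ Q0 | inj₂ Q        = inj₂ λ { zero → Q0 ; (suc i) → Q i }

-- Listing the words with a given number of zeros.

module WordList (p : ℕ) (1≤p : 1 ≤ p) (𝟘 : Fin (suc p)) where
  open Counting p 1≤p 𝟘

  -- Unranking along the recursion of `ν`: first the words with a nonzero first letter, then those
  -- that start with `𝟘`. The helpers take the decoded index, so that injectivity can be proved by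
  -- matching on it.
  word : ∀ r k → Fin (ν p r k) → Vec (Fin (suc p)) r
  word₁ : ∀ r k → Fin (p ℕ.* ν p r k) → Vec (Fin (suc p)) (suc r)
  word₂ : ∀ r k → Fin (p ℕ.* ν p r (suc k)) ⊎ Fin (ν p r k) → Vec (Fin (suc p)) (suc r)

  word zero    _       _ = []
  word (suc r) zero    i = word₁ r zero i
  word (suc r) (suc k) i = word₂ r k (splitAt (p ℕ.* ν p r (suc k)) i)
  word₁ r k i = let a , j = remQuot {p} (ν p r k) i in punchIn 𝟘 a ∷ word r k j
  word₂ r k (inj₁ i) = word₁ r (suc k) i
  word₂ r k (inj₂ i) = 𝟘 ∷ word r k i

  word-injective : ∀ r k i j → word r k i ≡ word r k j → i ≡ j
  word₁-injective : ∀ r k i j → word₁ r k i ≡ word₁ r k j → i ≡ j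
  word₂-injective : ∀ r k i j → word₂ r k i ≡ word₂ r k j → i ≡ j

  word-injective zero    zero    zero zero _ = ≡.refl
  word-injective (suc r) zero    i j eq = word₁-injective r zero i j eq
  word-injective (suc r) (suc k) i j eq = begin
    i                                                       ≡⟨ Fin.join-splitAt (p ℕ.* ν p r (suc k)) (ν p r k) i ⟨
    join _ (ν p r k) (splitAt (p ℕ.* ν p r (suc k)) i)      ≡⟨ ≡.cong (join (p ℕ.* ν p r (suc k)) (ν p r k)) (word₂-injective r k _ _ eq) ⟩
    join _ (ν p r k) (splitAt (p ℕ.* ν p r (suc k)) j)      ≡⟨ Fin.join-splitAt (p ℕ.* ν p r (suc k)) (ν p r k) j ⟩
    j                                                       ∎
    where open ≡.≡-Reasoning
  word₁-injective r k i j eq = begin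
    i                                           ≡⟨ Fin.combine-remQuot {p} (ν p r k) i ⟨
    uncurry combine (remQuot {p} (ν p r k) i)   ≡⟨ ≡.cong₂ combine
                                                     (Fin.punchIn-injective 𝟘 _ _ (proj₁ (∷-injective eq)))
                                                     (word-injective r k _ _ (proj₂ (∷-injective eq))) ⟩
    uncurry combine (remQuot {p} (ν p r k) j)   ≡⟨ Fin.combine-remQuot {p} (ν p r k) j ⟩
    j                                           ∎
    where open ≡.≡-Reasoning
  word₂-injective r k (inj₁ i) (inj₁ j) eq = ≡.cong inj₁ (word₁-injective r (suc k) i j eq)
  word₂-injective r k (inj₁ i) (inj₂ j) eq = contradiction (proj₁ (∷-injective eq)) (Fin.punchInᵢ≢i 𝟘 _)
  word₂-injective r k (inj₂ i) (inj₁ j) eq = contradiction (≡.sym (proj₁ (∷-injective eq))) (Fin.punchInᵢ≢i 𝟘 _)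
  word₂-injective r k (inj₂ i) (inj₂ j) eq = ≡.cong inj₂ (word-injective r k i j (proj₂ (∷-injective eq)))

  zeros-word : ∀ r k i → zeros (word r k i) ≡ k
  zeros-word₁ : ∀ r k i → zeros (word₁ r k i) ≡ k
  zeros-word₂ : ∀ r k i → zeros (word₂ r k i) ≡ suc k
  zeros-word zero    zero    _ = ≡.refl
  zeros-word (suc r) zero    i = zeros-word₁ r zero i
  zeros-word (suc r) (suc k) i = zeros-word₂ r k (splitAt (p ℕ.* ν p r (suc k)) i)
  zeros-word₁ r k i = ≡.cong₂ ℕ._+_ (⟦⟧-false (𝟘 Fin.≟ punchIn 𝟘 _) (Fin.punchInᵢ≢i 𝟘 _ ∘ ≡.sym)) (zeros-word r k _)
  zeros-word₂ r k (inj₁ i) = zeros-word₁ r (suc k) i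
  zeros-word₂ r k (inj₂ i) = ≡.cong₂ ℕ._+_ (⟦⟧-true (𝟘 Fin.≟ 𝟘) ≡.refl) (zeros-word r k i)

-- Words over a finite field and linear functionals.

module Code {c ℓ} (p : ℕ) (2≤p : 2 ≤ p) (F : FiniteField c ℓ (suc p)) where
  open FiniteField F hiding (zero)

  index : Carrier → Fin (suc p)
  index x = proj₁ (enum-surj x)

  enum-index : ∀ x → enum (index x) ≈ x
  enum-index x = proj₂ (enum-surj x)

  _≈?_ : Decidable _≈_
  x ≈? y = map′
    (λ eq → trans (sym (enum-index x)) (trans (reflexive (≡.cong enum eq)) (enum-index y)))
    (λ x≈y → enum-inj _ _ (trans (enum-index x) (trans x≈y (sym (enum-index y)))))
    (index x Fin.≟ index y)

  𝟘 : Fin (suc p)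
  𝟘 = index 0#

  1≤p : 1 ≤ p
  1≤p = ℕ.≤-trans (s≤s z≤n) 2≤p

  open Growth p 1≤p
  open Counting p 1≤p 𝟘
  open WordList p 1≤p 𝟘
  open Linear field′ _≈?_
  open import Algebra.Properties.Semiring.Sum semiring using (sum; sum-cong-≋; sum-remove)

  enum≈0⇒ : ∀ {a} → enum a ≈ 0# → 𝟘 ≡ a
  enum≈0⇒ {a} a≈0 = enum-inj 𝟘 a (trans (enum-index 0#) (sym a≈0))

  enum≈0⇐ : ∀ {a} → 𝟘 ≡ a → enum a ≈ 0#
  enum≈0⇐ ≡.refl = enum-index 0#

  dot : ∀ {r} → (Fin r → Carrier) → Vec (Fin (suc p)) r → Carrier
  dot a x = sum (λ l → a l * enum (lookup x l))

  dot-insertAt : ∀ {n} (a : Fin (suc n) → Carrier) x i b →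
                 dot a (insertAt x i b) ≈ a i * enum b + dot (a ∘ punchIn i) x
  dot-insertAt {n} a x i b = trans (sum-remove {i = i} λ l → a l * enum (lookup (insertAt x i b) l)) (+-cong
    (*-congˡ (reflexive (≡.cong enum (insertAt-lookup x i b))))
    (sum-cong-≋ {n} λ l → *-congˡ (reflexive (≡.cong enum (insertAt-punchIn x i b l)))))

  -- At most one of two distinct nonzero values of b forces b′ = 0, so q ≥ 3 is needed.
  solvable : ∀ a d s → ¬ a ≈ 0# → ¬ d ≈ 0# →
             ∃ λ b → ∃ λ b′ → 𝟘 ≢ b × 𝟘 ≢ b′ × a * enum b + (d * enum b′ + s) ≈ 0#
  solvable a d s a≉0 d≉0 = complete choice
    where
    open import Algebra.Properties.Group +-group using (∙-cancelʳ)
    nonzero-elt : Fin p → Fin (suc p)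
    nonzero-elt = punchIn 𝟘
    v₀ v₁ : Fin p
    v₀ = Fin.fromℕ< 1≤p
    v₁ = Fin.fromℕ< 2≤p
    v₀≢v₁ : v₀ ≢ v₁
    v₀≢v₁ eq with ≡.trans (≡.sym (Fin.toℕ-fromℕ< 1≤p)) (≡.trans (≡.cong Fin.toℕ eq) (Fin.toℕ-fromℕ< 2≤p))
    ... | ()
    value : Fin p → Carrier
    value v = a * enum (nonzero-elt v) + s
    choice : ∃ λ v → ¬ value v ≈ 0#
    choice with value v₀ ≈? 0#
    ... | no  v₀≉0 = v₀ , v₀≉0
    ... | yes v₀≈0 = v₁ , λ v₁≈0 → v₀≢v₁ (Fin.punchIn-injective 𝟘 v₀ v₁ (enum-inj _ _
            (*-cancelˡ-≉0 a _ _ a≉0 (∙-cancelʳ s _ _ (trans v₀≈0 (sym v₁≈0))))))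
    complete : (∃ λ v → ¬ value v ≈ 0#) → _
    complete (v , t≉0) = b , b′ , (Fin.punchInᵢ≢i 𝟘 v ∘ ≡.sym) , b′≢𝟘 , solved
      where
      open import Relation.Binary.Reasoning.Setoid setoid
      open import Algebra.Properties.CommutativeSemigroup +-commutativeSemigroup using (x∙yz≈y∙xz)
      t e : Carrier
      b b′ : Fin (suc p)
      b = nonzero-elt v
      t = value v
      e = proj₁ (inverse d d≉0)
      -- The solution of `d * enum b′ ≈ - t`; it is nonzero because `t` is.
      b′ = index (e * - t)
      db′ : d * enum b′ ≈ - t
      db′ = begin
        d * enum b′    ≈⟨ *-congˡ (enum-index _) ⟩
        d * (e * - t)  ≈⟨ *-assoc d e (- t) ⟨
        d * e * - t    ≈⟨ *-congʳ (proj₂ (inverse d d≉0)) ⟩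
        1# * - t       ≈⟨ *-identityˡ (- t) ⟩
        - t            ∎
      solved : a * enum b + (d * enum b′ + s) ≈ 0#
      solved = begin
        a * enum b + (d * enum b′ + s)  ≈⟨ x∙yz≈y∙xz _ _ _ ⟩
        d * enum b′ + t                 ≈⟨ +-congʳ db′ ⟩
        - t + t                         ≈⟨ -‿inverseˡ t ⟩
        0#                              ∎
      b′≢𝟘 : 𝟘 ≢ b′
      b′≢𝟘 eq = t≉0 (begin
        t                 ≈⟨ +-identityˡ t ⟨
        0# + t            ≈⟨ +-congʳ (trans (*-congˡ (enum≈0⇐ eq)) (zeroʳ d)) ⟨
        d * enum b′ + t   ≈⟨ +-congʳ db′ ⟩
        - t + t           ≈⟨ -‿inverseˡ t ⟩
        0#                ∎)

  -- Indicator of the words lost to a row `a`: they have `k` zero coordinates, and the row adds one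
  -- more zero.
  vanishing : ∀ {r} → (Fin r → Carrier) → ℕ → Vec (Fin (suc p)) r → ℕ
  vanishing a k x = ⟦ zeros x ℕ.≟ k ⟧ ℕ.* ⟦ dot a x ≈? 0# ⟧

  -- Every word on the remaining coordinates extends to a zero of the functional, without
  -- new zero coordinates.
  vanishing-words : ∀ n k (a : Fin (2 ℕ.+ n) → Carrier) {i j} → i ≢ j → ¬ a i ≈ 0# → ¬ a j ≈ 0# →
                    ν p n k ≤ ∑ⱽ (2 ℕ.+ n) (vanishing a k)
  vanishing-words n k a {i} {j} i≢j ai≉0 aj≉0 = begin
    ν p n k
      ≡⟨ count-zeros n k ⟨
    ∑ⱽ n (λ y → ⟦ zeros y ℕ.≟ k ⟧)
      ≤⟨ ∑ⱽ-mono n extend ⟩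
    ∑ⱽ n (λ y → ∑ℕ (λ b → ∑ℕ (λ b′ → φ b b′ y)))
      ≡⟨ ∑ⱽ-sum-comm n (λ y b → ∑ℕ (λ b′ → φ b b′ y)) ⟩
    ∑ℕ (λ b → ∑ⱽ n (λ y → ∑ℕ (λ b′ → φ b b′ y)))
      ≡⟨ ∑ℕ-cong {suc p} (λ b → ≡.trans (∑ⱽ-sum-comm n (λ y b′ → φ b b′ y))
           (≡.sym (∑ⱽ-insertAt n (λ x → vanishing a k (insertAt x i b)) j′))) ⟩
    ∑ℕ (λ b → ∑ⱽ (suc n) (λ x → vanishing a k (insertAt x i b)))
      ≡⟨ ∑ⱽ-insertAt (suc n) (vanishing a k) i ⟨
    ∑ⱽ (2 ℕ.+ n) (vanishing a k) ∎
    where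
    open ℕ.≤-Reasoning
    -- The position of `j` once coordinate `i` is deleted.
    j′ : Fin (suc n)
    j′ = punchOut i≢j
    aj′≉0 : ¬ a (punchIn i j′) ≈ 0#
    aj′≉0 = ≡.subst (λ l → ¬ a l ≈ 0#) (≡.sym (Fin.punchIn-punchOut i≢j)) aj≉0
    φ : Fin (suc p) → Fin (suc p) → Vec (Fin (suc p)) n → ℕ
    φ b b′ y = vanishing a k (insertAt (insertAt y j′ b′) i b)
    extend : ∀ y → ⟦ zeros y ℕ.≟ k ⟧ ≤ ∑ℕ (λ b → ∑ℕ (λ b′ → φ b b′ y))
    extend y =
      let s = dot (a ∘ punchIn i ∘ punchIn j′) y
          b , b′ , b≢ , b′≢ , solved = solvable (a i) (a (punchIn i j′)) s ai≉0 aj′≉0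
          x = insertAt (insertAt y j′ b′) i b
          zeros≡ : zeros x ≡ zeros y
          zeros≡ = ≡.trans (zeros-insertAt (insertAt y j′ b′) i b)
            (≡.cong₂ ℕ._+_ (⟦⟧-false (𝟘 Fin.≟ b) b≢)
              (≡.trans (zeros-insertAt y j′ b′) (≡.cong (ℕ._+ zeros y) (⟦⟧-false (𝟘 Fin.≟ b′) b′≢))))
          dot≈0 : dot a x ≈ 0#
          dot≈0 = trans (dot-insertAt a (insertAt y j′ b′) i b)
            (trans (+-congˡ (dot-insertAt (a ∘ punchIn i) y j′ b′)) solved)
      in begin
      ⟦ zeros y ℕ.≟ k ⟧          ≡⟨ ≡.cong (λ z → ⟦ z ℕ.≟ k ⟧) zeros≡ ⟨
      ⟦ zeros x ℕ.≟ k ⟧          ≡⟨ ℕ.*-identityʳ _ ⟨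
      ⟦ zeros x ℕ.≟ k ⟧ ℕ.* 1    ≡⟨ ≡.cong (⟦ zeros x ℕ.≟ k ⟧ ℕ.*_) (⟦⟧-true (dot a x ≈? 0#) dot≈0) ⟨
      φ b b′ y                   ≤⟨ term≤sum (λ b′ → φ b b′ y) b′ ⟩
      ∑ℕ (λ b′ → φ b b′ y)       ≤⟨ term≤sum (λ b → ∑ℕ (λ b′ → φ b b′ y)) b ⟩
      ∑ℕ (λ b → ∑ℕ (λ b′ → φ b b′ y)) ∎

  -- Counting words together with additional rows.

  extra-zeros : ∀ {e r} → Matrix field′ e r → Vec (Fin (suc p)) r → ℕ
  extra-zeros A x = ∑ℕ (λ u → ⟦ dot (A u) x ≈? 0# ⟧)

  -- The coordinates of `x` stand for the basis rows of a matrix column, the functionals `A` for its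
  -- remaining rows.
  count : ∀ {e} r → Matrix field′ e r → ℕ → ℕ
  count r A k = ∑ⱽ r (λ x → ⟦ zeros x ℕ.+ extra-zeros A x ℕ.≟ k ⟧)

  extra-zeros≥1 : ∀ {e r} (A : Matrix field′ e r) x u → dot (A u) x ≈ 0# → 1 ≤ extra-zeros A x
  extra-zeros≥1 {e} A x u dot≈0 = ℕ.≤-trans (ℕ.≤-reflexive (≡.sym (⟦⟧-true (dot (A u) x ≈? 0#) dot≈0)))
    (term≤sum (λ u → ⟦ dot (A u) x ≈? 0# ⟧) u)

  TwoNonzero OneNonzero AllZero : ∀ {r} → (Fin r → Carrier) → Set ℓ
  TwoNonzero a = ∃ λ i → ∃ λ j → i ≢ j × ¬ a i ≈ 0# × ¬ a j ≈ 0#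
  OneNonzero a = ∃ λ i → ¬ a i ≈ 0# × (∀ j → i ≢ j → a j ≈ 0#)
  AllZero    a = ∀ i → a i ≈ 0#

  support : ∀ {r} (a : Fin r → Carrier) → TwoNonzero a ⊎ (AllZero a ⊎ OneNonzero a)
  support a with Fin.any? (λ i → ¬? (a i ≈? 0#))
  ... | no none = inj₂ (inj₁ λ i → decidable-stable (a i ≈? 0#) λ ai≉0 → none (i , ai≉0))
  ... | yes (i , ai≉0) with Fin.any? (λ j → ¬? (i Fin.≟ j) ×-dec ¬? (a j ≈? 0#))
  ...   | yes (j , i≢j , aj≉0) = inj₁ (i , j , i≢j , ai≉0 , aj≉0)
  ...   | no none = inj₂ (inj₂ (i , ai≉0 , λ j i≢j →
            decidable-stable (a j ≈? 0#) λ aj≉0 → none (j , i≢j , aj≉0)))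

  -- Words gained lie in `below`, words lost in `vanishing`, and there are at least as many of the
  -- latter. Adding `below` to both sides turns this comparison into a pointwise inequality of
  -- indicators.
  count-two : ∀ {e} n (A : Matrix field′ e (2 ℕ.+ n)) k → threshold k ≤ n →
              ∀ u → TwoNonzero (A u) → count (2 ℕ.+ n) A k ≤ ν p (2 ℕ.+ n) k
  count-two n A k t≤n u (i , j , i≢j , ai≉0 , aj≉0) = ℕ.+-cancelʳ-≤ (below r k) _ _ (begin
    count r A k ℕ.+ below r k
      ≤⟨ ℕ.+-monoʳ-≤ (count r A k) (ℕ.≤-trans (below≤ν n k t≤n) (vanishing-words n k (A u) i≢j ai≉0 aj≉0)) ⟩
    count r A k ℕ.+ ∑ⱽ r (vanishing (A u) k)
      ≡⟨ ∑ⱽ-distrib-+ r (λ x → ⟦ zeros x ℕ.+ extra-zeros A x ℕ.≟ k ⟧) (vanishing (A u) k) ⟨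
    ∑ⱽ r (λ x → ⟦ zeros x ℕ.+ extra-zeros A x ℕ.≟ k ⟧ ℕ.+ vanishing (A u) k x)
      ≤⟨ ∑ⱽ-mono r pointwise ⟩
    ∑ⱽ r (λ x → ⟦ zeros x ℕ.≟ k ⟧ ℕ.+ ⟦ zeros x ℕ.<? k ⟧)
      ≡⟨ ∑ⱽ-distrib-+ r (λ x → ⟦ zeros x ℕ.≟ k ⟧) (λ x → ⟦ zeros x ℕ.<? k ⟧) ⟩
    ∑ⱽ r (λ x → ⟦ zeros x ℕ.≟ k ⟧) ℕ.+ below r k
      ≡⟨ ≡.cong (ℕ._+ below r k) (count-zeros r k) ⟩
    ν p r k ℕ.+ below r k ∎)
    where
    open ℕ.≤-Reasoning
    r : ℕ
    r = 2 ℕ.+ n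
    -- A word with exactly `k` zero coordinates cannot be both counted and vanishing; any other
    -- counted word has fewer than `k`.
    arith : ∀ z E {d} {D : Set d} (D? : Dec D) → (D → 1 ≤ E) →
            ⟦ z ℕ.+ E ℕ.≟ k ⟧ ℕ.+ ⟦ z ℕ.≟ k ⟧ ℕ.* ⟦ D? ⟧ ≤ ⟦ z ℕ.≟ k ⟧ ℕ.+ ⟦ z ℕ.<? k ⟧
    arith z E {D = D} D? D⇒ = cases (z ℕ.≟ k) D?
      where
      cases : (z≡k? : Dec (z ≡ k)) (D? : Dec D) →
              ⟦ z ℕ.+ E ℕ.≟ k ⟧ ℕ.+ ⟦ z≡k? ⟧ ℕ.* ⟦ D? ⟧ ≤ ⟦ z≡k? ⟧ ℕ.+ ⟦ z ℕ.<? k ⟧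
      cases (yes z≡k) (yes x) = ℕ.≤-trans (ℕ.≤-reflexive (≡.cong (ℕ._+ 1)
        (⟦⟧-false (z ℕ.+ E ℕ.≟ k) λ eq → ℕ.<⇒≢ (ℕ.m<m+n z (D⇒ x)) (≡.trans z≡k (≡.sym eq)))))
        (ℕ.m≤m+n 1 _)
      cases (yes z≡k) (no _)  = ℕ.≤-trans (ℕ.≤-reflexive (ℕ.+-identityʳ _))
        (ℕ.≤-trans (⟦⟧≤1 (z ℕ.+ E ℕ.≟ k)) (ℕ.m≤m+n 1 _))
      cases (no z≢k)  _       = ℕ.≤-trans (ℕ.≤-reflexive (ℕ.+-identityʳ _))
        (⟦⟧-mono (z ℕ.+ E ℕ.≟ k) (z ℕ.<? k) λ eq → ℕ.≤∧≢⇒< (ℕ.m+n≤o⇒m≤o z (ℕ.≤-reflexive eq)) z≢k)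
    pointwise : ∀ x → ⟦ zeros x ℕ.+ extra-zeros A x ℕ.≟ k ⟧ ℕ.+ vanishing (A u) k x
                    ≤ ⟦ zeros x ℕ.≟ k ⟧ ℕ.+ ⟦ zeros x ℕ.<? k ⟧
    pointwise x = arith (zeros x) (extra-zeros A x) (dot (A u) x ≈? 0#) (extra-zeros≥1 A x u)

  -- A zero functional vanishes on every word, so a counted word has fewer than `k` zero
  -- coordinates.
  count-zero-row : ∀ {e} n (A : Matrix field′ e (2 ℕ.+ n)) k → threshold k ≤ n →
                   ∀ u → AllZero (A u) → count (2 ℕ.+ n) A k ≤ ν p (2 ℕ.+ n) k
  count-zero-row n A k t≤n u Au≈0 = ℕ.≤-trans
    (∑ⱽ-mono (2 ℕ.+ n) λ x → ⟦⟧-mono (zeros x ℕ.+ extra-zeros A x ℕ.≟ k) (zeros x ℕ.<? k) λ eq →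
      ℕ.<-≤-trans (ℕ.m<m+n (zeros x) (extra-zeros≥1 A x u (dot≈0 x))) (ℕ.≤-reflexive eq))
    (ℕ.≤-trans (below≤ν n k t≤n) (ν-mono p 1≤p k (ℕ.m≤n+m n 2)))
    where
    dot≈0 : ∀ x → dot (A u) x ≈ 0#
    dot≈0 x = sum-zero (λ l → A u l * enum (lookup x l)) λ l → trans (*-congʳ (Au≈0 l)) (zeroˡ _)

  -- Each row vanishes exactly when its one coordinate does, so a zero at coordinate `l` counts once
  -- for itself and once for every row supported at `l`. With no rows at all, every weight is one.
  count-one : ∀ {e} r (A : Matrix field′ e r) k → threshold k ≤ r →
              (∀ u → OneNonzero (A u)) → count r A k ≤ ν p r k
  count-one {e} r A k t≤r one = ℕ.≤-trans
    (ℕ.≤-reflexive (∑ⱽ-cong r λ x → ≡.cong (λ z → ⟦ z ℕ.≟ k ⟧) (as-weight x)))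
    (count-weight≤ν k r w (λ i → s≤s z≤n) t≤r)
    where
    open ≡.≡-Reasoning
    at : Fin e → Fin r
    at u = proj₁ (one u)
    multiplicity w : Fin r → ℕ
    multiplicity l = ∑ℕ (λ u → ⟦ at u Fin.≟ l ⟧)
    w l = suc (multiplicity l)
    dot≈ : ∀ u x → dot (A u) x ≈ A u (at u) * enum (lookup x (at u))
    dot≈ u x = sum-only (λ l → A u l * enum (lookup x l)) (at u) λ j at≢j →
      trans (*-congʳ (proj₂ (proj₂ (one u)) j at≢j)) (zeroˡ _)
    row : ∀ u x → ⟦ dot (A u) x ≈? 0# ⟧ ≡ δ (lookup x (at u))
    row u x = ⟦⟧-cong (dot (A u) x ≈? 0#) (𝟘 Fin.≟ lookup x (at u))
      (λ dot≈0 → enum≈0⇒ (*-cancelˡ-≉0 (A u (at u)) _ 0# (proj₁ (proj₂ (one u)))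
        (trans (sym (dot≈ u x)) (trans dot≈0 (sym (zeroʳ _))))))
      (λ eq → trans (dot≈ u x) (trans (*-congˡ (enum≈0⇐ eq)) (zeroʳ _)))
    as-weight : ∀ x → zeros x ℕ.+ extra-zeros A x ≡ weight w x
    as-weight x = begin
      zeros x ℕ.+ extra-zeros A x
        ≡⟨ ≡.cong (zeros x ℕ.+_) (∑ℕ-cong {e} λ u → ≡.trans (row u x) (≡.sym (sum-δ (at u) (λ l → δ (lookup x l))))) ⟩
      zeros x ℕ.+ ∑ℕ {e} (λ u → ∑ℕ {r} (λ l → ⟦ at u Fin.≟ l ⟧ ℕ.* δ (lookup x l)))
        ≡⟨ ≡.cong (zeros x ℕ.+_) (∑ℕ-comm {e} {r} _) ⟩
      zeros x ℕ.+ ∑ℕ {r} (λ l → ∑ℕ {e} (λ u → ⟦ at u Fin.≟ l ⟧ ℕ.* δ (lookup x l)))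
        ≡⟨ ≡.cong (zeros x ℕ.+_) (∑ℕ-cong {r} λ l → ≡.sym (*-distribʳ-∑ℕ (δ (lookup x l)) (λ u → ⟦ at u Fin.≟ l ⟧))) ⟩
      zeros x ℕ.+ ∑ℕ {r} (λ l → multiplicity l ℕ.* δ (lookup x l))
        ≡⟨ ∑ℕ-distrib-+ {r} _ _ ⟨
      weight w x ∎

  -- The two coordinates beyond `threshold k` are those spent on a row with two nonzero
  -- coefficients.
  count≤ν : ∀ {e} r (A : Matrix field′ e r) k → 2 ℕ.+ threshold k ≤ r → count r A k ≤ ν p r k
  count≤ν (suc (suc n)) A k (s≤s (s≤s t≤n)) with any⊎all (λ u → support (A u))
  ... | inj₁ (u , two) = count-two n A k t≤n u two
  ... | inj₂ rest with any⊎all rest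
  ...   | inj₁ (u , all-zero) = count-zero-row n A k t≤n u all-zero
  ...   | inj₂ one = count-one (2 ℕ.+ n) A k (ℕ.≤-trans t≤n (ℕ.m≤n+m n 2)) one

  -- With `N` the power of `suc p`, length `N + k` gives at least `2 ^ N`, hence at least `N`, words
  -- with `k` zeros, and `N` exceeds the number of all words shorter than `2 + threshold k` of any
  -- one length.
  bound : ℕ → ℕ
  bound k = suc p ^ (2 ℕ.+ threshold k) ℕ.+ k

  count≤ν-rank : ∀ {e s r} (A : Matrix field′ e s) k → s ≤ r → bound k ≤ r → count s A k ≤ ν p r k
  count≤ν-rank {s = s} {r} A k s≤r R≤r with 2 ℕ.+ threshold k ℕ.≤? s
  ... | yes t≤s = ℕ.≤-trans (count≤ν s A k t≤s) (ν-mono p 1≤p k s≤r)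
  ... | no  t≰s = begin
    count s A k                    ≤⟨ ∑ⱽ-mono s (λ x → ⟦⟧≤1 (zeros x ℕ.+ extra-zeros A x ℕ.≟ k)) ⟩
    ∑ⱽ {suc p} s (λ _ → 1)         ≡⟨ ∑ⱽ-const {suc p} s 1 ⟩
    suc p ^ s ℕ.* 1                ≡⟨ ℕ.*-identityʳ _ ⟩
    suc p ^ s                      ≤⟨ ℕ.^-monoʳ-≤ (suc p) (ℕ.<⇒≤ (ℕ.≰⇒> t≰s)) ⟩
    suc p ^ (2 ℕ.+ threshold k)    ≤⟨ n≤2^n (suc p ^ (2 ℕ.+ threshold k)) ⟩
    2 ^ (suc p ^ (2 ℕ.+ threshold k)) ≤⟨ 2^n≤ν p 2≤p (suc p ^ (2 ℕ.+ threshold k)) k ⟩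
    ν p (bound k) k                ≤⟨ ν-mono p 1≤p k R≤r ⟩
    ν p r k                        ∎
    where open ℕ.≤-Reasoning

  -- Upper and lower bounds for matrices.

  upper : ∀ r k → bound k ≤ r → ∀ m n (M : Matrix field′ m n) → Admissible field′ r k M → n ≤ ν p r k
  upper r k R≤r m n M (distinct , k-zeros , B , D , M≈BD) =
    let s , s≤r , rb = rowBasis r B in via s s≤r rb
    where
    via : ∀ s → s ≤ r → RowBasis B s → n ≤ ν p r k
    via s s≤r rb = ℕ.≤-trans
      (injection⇒≤∑ⱽ (λ x → zeros x ℕ.+ extra-zeros coeff x ℕ.≟ k) column column-injective column-zeros)
      (count≤ν-rank coeff k s≤r R≤r)
      where
      open RowBasis rb
      -- A matrix column is determined by its basis entries, since the other entries are fixed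
      -- functionals of them; distinct columns thus give distinct words.
      column : Fin n → Vec (Fin (suc p)) s
      column j = tabulate (λ l → index (M (basis l) j))
      entry : ∀ j l → enum (lookup (column j) l) ≈ M (basis l) j
      entry j l = trans (reflexive (≡.cong enum (lookup∘tabulate _ l))) (enum-index _)
      rest-entry : ∀ j u → dot (coeff u) (column j) ≈ M (rest u) j
      rest-entry j u = trans (sum-cong-≋ {s} λ l → *-congˡ (entry j l))
        (sym (factor-dependence B D M≈BD rb u j))
      column-injective : ∀ i j → column i ≡ column j → i ≡ j
      column-injective i j eq = decidable-stable (i Fin.≟ j) λ i≢j → distinct i j i≢j same
        where
        same : ∀ h → M h i ≈ M h j
        same h with covers h
        ... | inj₁ (l , ≡.refl) = trans (sym (entry i l)) (trans (reflexive (≡.cong (λ x → enum (lookup x l)) eq)) (entry j l))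
        ... | inj₂ (u , ≡.refl) = trans (sym (rest-entry i u)) (trans (reflexive (≡.cong (dot (coeff u)) eq)) (rest-entry j u))
      column-zeros : ∀ j → zeros (column j) ℕ.+ extra-zeros coeff (column j) ≡ k
      column-zeros j with k-zeros j
      ... | S , ∣S∣≡k , S⇔ = begin
        zeros (column j) ℕ.+ extra-zeros coeff (column j)
          ≡⟨ ≡.cong₂ ℕ._+_
               (∑ℕ-cong {s} λ l → ⟦⟧-cong (𝟘 Fin.≟ lookup (column j) l) (M (basis l) j ≈? 0#)
                 (λ eq → trans (sym (entry j l)) (enum≈0⇐ eq)) (λ M≈0 → enum≈0⇒ (trans (entry j l) M≈0)))
               (∑ℕ-cong {extra} λ u → ⟦⟧-cong (dot (coeff u) (column j) ≈? 0#) (M (rest u) j ≈? 0#)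
                 (trans (sym (rest-entry j u))) (trans (rest-entry j u))) ⟩
        ∑ℕ (λ l → ⟦ M (basis l) j ≈? 0# ⟧) ℕ.+ ∑ℕ (λ u → ⟦ M (rest u) j ≈? 0# ⟧)
          ≡⟨ sum-rows (λ i → ⟦ M i j ≈? 0# ⟧) ⟨
        ∑ℕ (λ i → ⟦ M i j ≈? 0# ⟧)
          ≡⟨ ∑ℕ-cong {m} (λ i → ⟦⟧-cong (M i j ≈? 0#) (lookup S i Bool.≟ inside)
               ([]=⇒lookup ∘ Equivalence.from (S⇔ i)) (Equivalence.to (S⇔ i) ∘ lookup⇒[]= i S)) ⟩
        ∑ℕ (λ i → ⟦ lookup S i Bool.≟ inside ⟧)
          ≡⟨ card≡∑ S ⟨
        ∣ S ∣
          ≡⟨ ∣S∣≡k ⟩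
        k ∎
        where open ≡.≡-Reasoning

  lower : ∀ r k → ∃ λ m → ∃ λ (M : Matrix field′ m (ν p r k)) → Admissible field′ r k M
  -- The columns are the words of length `r` with `k` zeros, and the rank bound comes from the
  -- factorization of `M` as identity times `M`.
  lower r k = r , M , distinct , k-zeros , identity , M , λ i j → sym (trans (sumF≈sum r _)
    (trans (sum-only _ i (λ l i≢l → trans (*-congʳ (identity-off i≢l)) (zeroˡ _)))
           (trans (*-congʳ (identity-on i)) (*-identityˡ _))))
    where
    M : Matrix field′ r (ν p r k)
    M i j = enum (lookup (word r k j) i)
    identity : Matrix field′ r r
    identity i l = Bool.if does (i Fin.≟ l) then 1# else 0#
    identity-off : ∀ {i l} → i ≢ l → identity i l ≈ 0#
    identity-off {i} {l} i≢l with i Fin.≟ l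
    ... | yes i≡l = contradiction i≡l i≢l
    ... | no _    = refl
    identity-on : ∀ i → identity i i ≈ 1#
    identity-on i with i Fin.≟ i
    ... | yes _  = refl
    ... | no i≢i = contradiction ≡.refl i≢i
    distinct : DistinctColumns field′ M
    distinct j j′ j≢j′ same = j≢j′ (word-injective r k j j′ (lookup-extensional _ _ λ i → enum-inj _ _ (same i)))
      where
      lookup-extensional : ∀ {r} (x y : Vec (Fin (suc p)) r) → (∀ i → lookup x i ≡ lookup y i) → x ≡ y
      lookup-extensional x y eq = ≡.trans (≡.sym (tabulate∘lookup x)) (≡.trans (tabulate-cong eq) (tabulate∘lookup y))
    k-zeros : ColumnsHaveKZeros field′ k M
    k-zeros j = S , ∣S∣≡k , λ i → mk⇔
      (λ i∈S → enum≈0⇐ (to-zero i ([]=⇒lookup i∈S)))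
      (λ M≈0 → lookup⇒[]= i S (from-zero i (enum≈0⇒ M≈0)))
      where
      S : Subset r
      S = tabulate (λ i → does (𝟘 Fin.≟ lookup (word r k j) i))
      to-zero : ∀ i → lookup S i ≡ inside → 𝟘 ≡ lookup (word r k j) i
      to-zero i eq = from-does (𝟘 Fin.≟ lookup (word r k j) i) (≡.trans (≡.sym (lookup∘tabulate _ i)) eq)
        where
        from-does : ∀ {a} {A : Set a} (d : Dec A) → does d ≡ true → A
        from-does (yes a) _ = a
      from-zero : ∀ i → 𝟘 ≡ lookup (word r k j) i → lookup S i ≡ inside
      from-zero i eq = ≡.trans (lookup∘tabulate _ i) (dec-true (𝟘 Fin.≟ lookup (word r k j) i) eq)
      ∣S∣≡k : ∣ S ∣ ≡ k
      ∣S∣≡k = ≡.trans (card≡∑ S) (≡.trans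
        (∑ℕ-cong {r} λ i → ⟦⟧-cong (lookup S i Bool.≟ inside) (𝟘 Fin.≟ lookup (word r k j) i) (to-zero i) (from-zero i))
        (zeros-word r k j))

  exBar : ∀ r k → bound k ≤ r → ExBarEq field′ r k ((r C k) ℕ.* p ^ (r ∸ k))
  exBar r k R≤r = ≡.subst (ExBarEq field′ r k) (ν-closed p r k) (lower r k , upper r k R≤r)

-- The theorem for each field order.

open import Data.Nat using (_+_; _*_)
open ≡ using (refl)

theorem2 : ∀ {c ℓ : Level} (q : ℕ) → IsPrimePower q → q ≢ 2 → ∀ (k : ℕ) → ∃ λ (R : ℕ) →
    ∀ (F : FiniteField c ℓ q) (r : ℕ) → R ≤ r →
    ExBarEq (FiniteField.field′ F) r k ((r C k) * (q ∸ 1) ^ (r ∸ k))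
-- No field has zero elements or one element, so any value of `R` serves for these orders.
theorem2 zero _ _ k = 0 , λ F → contradiction (proj₁ (FiniteField.enum-surj F (FiniteField.0# F))) λ ()
theorem2 (suc zero) _ _ k = 0 , λ F → contradiction (trivial F) (FiniteField.0≉1 F)
  where
  trivial : ∀ {c ℓ} (F : FiniteField c ℓ 1) → let open FiniteField F in 0# ≈ 1#
  trivial F with FiniteField.enum-surj F (FiniteField.0# F) | FiniteField.enum-surj F (FiniteField.1# F)
  ... | zero , e0 | zero , e1 = FiniteField.trans F (FiniteField.sym F e0) e1
theorem2 (suc (suc zero)) _ q≢2 k = contradiction refl q≢2
theorem2 (suc p@(suc (suc _))) _ _ k =
  -- This is `Code.bound` written out: its value does not depend on the field, and `R` is chosen
  -- before `F`.
  suc p ^ (2 + Growth.threshold p (s≤s z≤n) k) + k ,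
  λ F r R≤r → Code.exBar p (s≤s (s≤s z≤n)) F r k R≤r
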